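{- For a fixed permutation $\sigma$, there is an algorithm which, given a permutation $\pi$ as input, computes $\mathrm{NE}(\sigma,\pi)$ in time polynomial in the length of $\pi$.
   Context: A permutation of length $n\ge1$ is written in one-line notation $\pi=\pi_1\cdots\pi_n$. An occurrence of $\sigma$ in $\pi$ is a subsequence of $\pi$ (a choice of positions) whose letters are in the same relative order of size as the letters of $\sigma$. An adjacency in a permutation $\pi$ is a maximal sequence (of length $\ge 1$) of letters in consecutive positions that have consecutive values and are increasing or decreasing. The tail of an adjacency of length at least 2 is all but its first letter; an adjacency of length 1 has no tail. An embedding $\eta$ of $\sigma$ in $\pi$ is a sequence of the same length as $\pi$ whose nonzero letters are the letters of an occurrence of $\sigma$ in $\pi$, in the same positions as in $\pi$, all other entries being $0$. An embedding $\eta$ is normal if $\eta_i\neq 0$ at every position $i$ of a letter belonging to the tail of an adjacency of $\pi$. $\mathrm{NE}(\sigma,\pi)$ is the number of normal embeddings of $\sigma$ in $\pi$. -}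

module Defs where

open import Data.Bool.Base using (if_then_else_)
open import Data.Fin.Base using (Fin; zero; suc; toℕ) renaming (_<_ to _<ᶠ_; _≤_ to _≤ᶠ_)
open import Data.Fin.Permutation using (Permutation′; _⟨$⟩ʳ_)
open import Data.Fin.Properties using (any?; all?) renaming (_≟_ to _≟ᶠ_; _<?_ to _<ᶠ?_; _≤?_ to _≤ᶠ?_)
open import Data.List.Base using (List; []; _∷_; [_]; length; filter; allFin; cartesianProductWith; tabulate)
open import Data.Nat.Base using (ℕ; zero; suc; _+_; _∸_)
open import Data.Nat.Properties using () renaming (_≟_ to _≟ⁿ_)
open import Data.Product.Base using (∃; ∃-syntax; _×_; _,_)
open import Data.Vec.Base using (Vec; []; _∷_; lookup)
open import Data.Vec.Membership.Propositional using (_∉_)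
open import Data.Vec.Membership.DecPropositional using (_∈?_)
open import Function.Base using (_∘_)
open import Relation.Binary.PropositionalEquality using (_≡_; _≢_)
open import Relation.Nullary.Decidable using (Dec; does; ¬?; _×-dec_; _⊎-dec_; _→-dec_; map′)
open import Relation.Unary using (Pred; Decidable)
open import Data.Sum.Base using (_⊎_)
open import Level using (0ℓ)

private
  variable
    m n q : ℕ

allSequences : ∀ q n → List (Vec (Fin q) n)
allSequences q zero    = [ [] ]
allSequences q (suc n) = cartesianProductWith _∷_ (allFin q) (allSequences q n)

anySequence? : {P : Pred (Vec (Fin q) n) 0ℓ} → Decidable P → Dec (∃ P)
anySequence? {n = zero}  P? = map′ (λ p → [] , p) (λ where ([] , p) → p) (P? [])
anySequence? {n = suc n} P? =
  map′ (λ (x , xs , p) → x ∷ xs , p) (λ where (x ∷ xs , p) → x , xs , p)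
       (any? λ x → anySequence? (P? ∘ (x ∷_)))

-- Permutations of length n are bijections of Fin n, so positions count from 0.
-- Letters are shifted to 1, …, n, leaving 0 free to mark the unused positions
-- of an embedding.

letter : Permutation′ n → Fin n → Fin (suc n)
letter π i = suc (π ⟨$⟩ʳ i)

-- ι lists the chosen positions from left to right.

IsOccurrence : Permutation′ m → Permutation′ n → Vec (Fin n) m → Set
IsOccurrence {m} σ π ι =
  (∀ (j k : Fin m) → j <ᶠ k → lookup ι j <ᶠ lookup ι k) ×
  (∀ (j k : Fin m) →
    (letter σ j <ᶠ letter σ k → letter π (lookup ι j) <ᶠ letter π (lookup ι k)) ×
    (letter π (lookup ι j) <ᶠ letter π (lookup ι k) → letter σ j <ᶠ letter σ k))

IsEmbedding : Permutation′ m → Permutation′ n → Vec (Fin (suc n)) n → Set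
IsEmbedding {m} {n} σ π η =
  ∃[ ι ] IsOccurrence σ π ι ×
    (∀ (j : Fin m) → lookup η (lookup ι j) ≡ letter π (lookup ι j)) ×
    (∀ (i : Fin n) → i ∉ ι → lookup η i ≡ zero)

-- Intervals of positions are given by their first and last positions a and b.

Increasing Decreasing IsRun : Permutation′ n → Fin n → Fin n → Set
Increasing {n} π a b = ∀ (i j : Fin n) → a ≤ᶠ i → j ≤ᶠ b → toℕ j ≡ suc (toℕ i) →
  toℕ (letter π j) ≡ suc (toℕ (letter π i))
Decreasing {n} π a b = ∀ (i j : Fin n) → a ≤ᶠ i → j ≤ᶠ b → toℕ j ≡ suc (toℕ i) →
  toℕ (letter π i) ≡ suc (toℕ (letter π j))
IsRun π a b = a ≤ᶠ b × (Increasing π a b ⊎ Decreasing π a b)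

IsAdjacency : Permutation′ n → Fin n → Fin n → Set
IsAdjacency {n} π a b = IsRun π a b ×
  (∀ (a′ b′ : Fin n) → a′ ≤ᶠ a → b ≤ᶠ b′ → IsRun π a′ b′ → a′ ≡ a × b′ ≡ b)

InTail : Permutation′ n → Fin n → Set
InTail π i = ∃[ a ] ∃[ b ] IsAdjacency π a b × a <ᶠ i × i ≤ᶠ b

IsNormalEmbedding : Permutation′ m → Permutation′ n → Vec (Fin (suc n)) n → Set
IsNormalEmbedding {n = n} σ π η =
  IsEmbedding σ π η × (∀ (i : Fin n) → InTail π i → lookup η i ≢ zero)

isOccurrence? : (σ : Permutation′ m) (π : Permutation′ n) → Decidable (IsOccurrence σ π)
isOccurrence? σ π ι =
  (all? λ j → all? λ k → (j <ᶠ? k) →-dec (lookup ι j <ᶠ? lookup ι k)) ×-dec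
  (all? λ j → all? λ k →
    ((letter σ j <ᶠ? letter σ k) →-dec (letter π (lookup ι j) <ᶠ? letter π (lookup ι k))) ×-dec
    ((letter π (lookup ι j) <ᶠ? letter π (lookup ι k)) →-dec (letter σ j <ᶠ? letter σ k)))

isEmbedding? : (σ : Permutation′ m) (π : Permutation′ n) → Decidable (IsEmbedding σ π)
isEmbedding? σ π η = anySequence? λ ι →
  isOccurrence? σ π ι ×-dec
  (all? λ j → lookup η (lookup ι j) ≟ᶠ letter π (lookup ι j)) ×-dec
  (all? λ i → ¬? (_∈?_ _≟ᶠ_ i ι) →-dec (lookup η i ≟ᶠ zero))

isRun? : (π : Permutation′ n) (a b : Fin n) → Dec (IsRun π a b)
isRun? π a b = (a ≤ᶠ? b) ×-dec
  ((all? λ i → all? λ j → (a ≤ᶠ? i) →-dec (j ≤ᶠ? b) →-dec (toℕ j ≟ⁿ suc (toℕ i)) →-dec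
      (toℕ (letter π j) ≟ⁿ suc (toℕ (letter π i)))) ⊎-dec
   (all? λ i → all? λ j → (a ≤ᶠ? i) →-dec (j ≤ᶠ? b) →-dec (toℕ j ≟ⁿ suc (toℕ i)) →-dec
      (toℕ (letter π i) ≟ⁿ suc (toℕ (letter π j)))))

isAdjacency? : (π : Permutation′ n) (a b : Fin n) → Dec (IsAdjacency π a b)
isAdjacency? π a b = isRun? π a b ×-dec
  (all? λ a′ → all? λ b′ → (a′ ≤ᶠ? a) →-dec (b ≤ᶠ? b′) →-dec isRun? π a′ b′ →-dec
    ((a′ ≟ᶠ a) ×-dec (b′ ≟ᶠ b)))

inTail? : (π : Permutation′ n) → Decidable (InTail π)
inTail? π i = any? λ a → any? λ b → isAdjacency? π a b ×-dec (a <ᶠ? i) ×-dec (i ≤ᶠ? b)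

isNormalEmbedding? : (σ : Permutation′ m) (π : Permutation′ n) → Decidable (IsNormalEmbedding σ π)
isNormalEmbedding? σ π η =
  isEmbedding? σ π η ×-dec (all? λ i → inTail? π i →-dec ¬? (lookup η i ≟ᶠ zero))

-- The entries of an embedding are 0 or letters of π, so ranging over
-- sequences with entries in Fin (suc n) misses none.

NE : Permutation′ m → Permutation′ n → ℕ
NE {n = n} σ π = length (filter (isNormalEmbedding? σ π) (allSequences (suc n) n))

-- The model of computation is a random access machine with structured control:
-- registers and memory cells, both indexed by ℕ, hold natural numbers, and every
-- assignment and every test costs one unit of time. As there is addition and
-- subtraction but no multiplication, the numbers occurring within t steps have
-- O(t + log N) bits, where N bounds the numbers in the input and the program, so
-- running time agrees with that of Turing machines up to a polynomial.

Register : Set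
Register = ℕ

infix  6 _≔const_ _≔_ _≔_⊕_ _≔_⊖_ _≔load_ store_at_
infixr 5 _⨾_

data Program : Set where
  skip      : Program
  _≔const_  : Register → ℕ → Program
  _≔_       : Register → Register → Program
  _≔_⊕_     : Register → Register → Register → Program
  _≔_⊖_     : Register → Register → Register → Program  -- truncated subtraction
  _≔load_   : Register → Register → Program             -- address in the second register
  store_at_ : Register → Register → Program             -- address in the second register
  _⨾_       : Program → Program → Program
  ifNonzero_then_else_ : Register → Program → Program → Program
  whileNonzero_repeat_     : Register → Program → Program

record State : Set where
  constructor ⟨_,_⟩
  field
    reg : Register → ℕ
    mem : ℕ → ℕ

open State public

_[_↦_] : (ℕ → ℕ) → ℕ → ℕ → (ℕ → ℕ)
(f [ x ↦ v ]) y = if does (y ≟ⁿ x) then v else f y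

setReg : Register → ℕ → State → State
setReg x v s = ⟨ reg s [ x ↦ v ] , mem s ⟩

setMem : ℕ → ℕ → State → State
setMem a v s = ⟨ reg s , mem s [ a ↦ v ] ⟩

-- p / s ⇓ s′ [ t ]: started in state s, p halts in state s′ after time t.

infix 4 _/_⇓_[_]

data _/_⇓_[_] : Program → State → State → ℕ → Set where
  ⇓skip  : ∀ {s} → skip / s ⇓ s [ 1 ]
  ⇓const : ∀ {s x k} → x ≔const k / s ⇓ setReg x k s [ 1 ]
  ⇓copy  : ∀ {s x y} → x ≔ y / s ⇓ setReg x (reg s y) s [ 1 ]
  ⇓add   : ∀ {s x y z} → x ≔ y ⊕ z / s ⇓ setReg x (reg s y + reg s z) s [ 1 ]
  ⇓sub   : ∀ {s x y z} → x ≔ y ⊖ z / s ⇓ setReg x (reg s y ∸ reg s z) s [ 1 ]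
  ⇓load  : ∀ {s x y} → x ≔load y / s ⇓ setReg x (mem s (reg s y)) s [ 1 ]
  ⇓store : ∀ {s x y} → store x at y / s ⇓ setMem (reg s y) (reg s x) s [ 1 ]
  ⇓seq   : ∀ {p q s s′ s″ t u} → p / s ⇓ s′ [ t ] → q / s′ ⇓ s″ [ u ] →
           p ⨾ q / s ⇓ s″ [ t + u ]
  ⇓then  : ∀ {x p q s s′ t} → reg s x ≢ 0 → p / s ⇓ s′ [ t ] →
           ifNonzero x then p else q / s ⇓ s′ [ suc t ]
  ⇓else  : ∀ {x p q s s′ t} → reg s x ≡ 0 → q / s ⇓ s′ [ t ] →
           ifNonzero x then p else q / s ⇓ s′ [ suc t ]
  ⇓done  : ∀ {x p s} → reg s x ≡ 0 → whileNonzero x repeat p / s ⇓ s [ 1 ]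
  ⇓loop  : ∀ {x p s s′ s″ t u} → reg s x ≢ 0 → p / s ⇓ s′ [ t ] →
           whileNonzero x repeat p / s′ ⇓ s″ [ u ] →
           whileNonzero x repeat p / s ⇓ s″ [ suc (t + u) ]

-- The input list occupies the memory from address 0 on and its length is in
-- register 0; everything else is 0. The output is left in register 0.

entry : List ℕ → ℕ → ℕ
entry []       _       = 0
entry (x ∷ _)  zero    = x
entry (_ ∷ xs) (suc i) = entry xs i

initial : List ℕ → State
initial xs = ⟨ (λ _ → 0) [ 0 ↦ length xs ] , entry xs ⟩

_on_Outputs_InTime_ : Program → List ℕ → ℕ → ℕ → Set
p on xs Outputs v InTime t = ∃[ s ] p / initial xs ⇓ s [ t ] × reg s 0 ≡ v

oneLine : Permutation′ n → List ℕ
oneLine π = tabulate (toℕ ∘ letter π)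

{-# OPTIONS --safe #-}

-- Normal embeddings of σ correspond to the occurrences of σ in π that cover all
-- tails of adjacencies.  For fixed σ, being such an occurrence is expressed by a
-- first-order formula over the positions of π, of a size depending only on σ.
-- The truth of a formula is the vanishing of an arithmetical term in which
-- quantifiers become sums over all positions; hence the number of tuples that
-- satisfy it is the value of a nested sum, computed by nested loops whose depth
-- is independent of π.

module Submission where

open import Defs
open import Data.Bool.Base using (if_then_else_)
open import Data.Fin.Base using (Fin; zero; suc; toℕ; fromℕ; inject₁)
  renaming (_<_ to _<ᶠ_)
open import Data.Fin.Permutation using (Permutation′)
open import Data.Fin.Properties using (any?; toℕ-fromℕ; toℕ-inject₁; toℕ-injective)
  renaming (_≟_ to _≟ᶠ_; _<?_ to _<ᶠ?_; <-irrefl to <ᶠ-irrefl; <-asym to <ᶠ-asym)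
open import Data.List.Base
  using (List; []; _∷_; _++_; allFin; cartesianProductWith; filter; length; map; tabulate)
open import Data.List.Membership.Propositional using (_∈_)
open import Data.List.Membership.Propositional.Properties
  using (∈-allFin; ∈-cartesianProductWith⁺; ∈-filter⁺; ∈-filter⁻; ∈-map⁺; ∈-map⁻)
open import Data.List.Membership.Propositional.Properties.WithK using (unique∧set⇒bag)
open import Data.List.Properties
  using (length-map; length-tabulate; map-++; map-cong; map-tabulate; map-∘)
open import Data.List.Relation.Binary.BagAndSetEquality using (∼bag⇒↭)
open import Data.List.Relation.Binary.Permutation.Propositional.Properties using (↭-length)
open import Data.List.Relation.Unary.All as All using (All; []; _∷_)
open import Data.List.Relation.Unary.All.Properties using (all-filter)
  renaming (map⁺ to all-map⁺)
open import Data.List.Relation.Unary.AllPairs using ([]; _∷_)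
open import Data.List.Relation.Unary.Any using (here)
open import Data.List.Relation.Unary.Unique.Propositional using (Unique)
open import Data.List.Relation.Unary.Unique.Propositional.Properties
  using (allFin⁺; cartesianProductWith⁺; filter⁺)
open import Data.Nat.Base using (ℕ; zero; suc; NonZero; _+_; _∸_; _*_; _^_; _≤_; _<_; z<s; s<s)
open import Data.Nat.ListAction using () renaming (sum to sumˡ)
open import Data.Nat.ListAction.Properties using (sum-++)
open import Data.Nat.Properties
  using (*-assoc; *-comm; *-distribʳ-+; *-identityʳ; *-monoʳ-≤; +-assoc; +-comm; +-identityʳ;
        +-mono-≤; 0∸n≡0; 1+n≢0; <-≤-trans; ^-monoʳ-≤; m+n≡0⇒m≡0; m+n≡0⇒n≡0; m<n⇒m<1+n; <⇒≢; <⇒≤;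
        >⇒≢; m∸n≡0⇒m≤n; m≤m+n; m≤n+m; m≤n⇒m∸n≡0; n<1+n; n≤1+n; ≤-antisym; ≤-refl; ≤-reflexive;
        ≤-trans; _≟_; +-0-monoid; module ≤-Reasoning)
open import Data.Product.Base using (∃-syntax; _×_; _,_; proj₁; proj₂)
open import Data.Sum.Base using (_⊎_; inj₁; inj₂; [_,_]′)
open import Data.Vec.Base as Vec using (Vec; []; _∷_; lookup)
open import Data.Vec.Membership.DecPropositional using (_∈?_)
import Data.Vec.Membership.Propositional as Vec∈
open import Data.Vec.Membership.Propositional.Properties using (∈-lookup)
open import Data.Vec.Properties using (∷-injective; lookup∘tabulate; tabulate∘lookup; tabulate-cong)
open import Data.Vec.Relation.Unary.Any as Any using (here; there)
open import Data.Vec.Relation.Unary.Any.Properties using (lookup-index)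
open import Function.Base using (_∘_; id)
open import Function.Bundles using (_⇔_; mk⇔; Equivalence)
open import Level using (0ℓ)
open import Relation.Binary.PropositionalEquality
  using (_≡_; _≢_; _≗_; refl; sym; trans; cong; cong₂; subst; module ≡-Reasoning)
open import Relation.Nullary.Decidable
  using (Dec; yes; no; does; dec-true; dec-false; decidable-stable; map′; _⊎-dec_)
open import Relation.Nullary.Negation using (¬_; contradiction)
open import Relation.Unary using (Pred; Decidable)

open import Algebra.Properties.Monoid.Sum +-0-monoid using (sum; sum-init-last)

private
  variable
    k m n q : ℕ

-- Arithmetical terms and their compilation to programs.

data Term (k : ℕ) : Set where
  const             : ℕ → Term k
  position letterAt : Fin k → Term k
  _+ᵗ_ _∸ᵗ_         : Term k → Term k → Term k
  ∑ᵗ                : Term (suc k) → Term k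

infixl 6 _+ᵗ_ _∸ᵗ_

value : Term k → Permutation′ n → Vec (Fin n) k → ℕ
value (const c)    π ρ = c
value (position x) π ρ = toℕ (lookup ρ x)
value (letterAt x) π ρ = toℕ (letter π (lookup ρ x))
value (a +ᵗ b)     π ρ = value a π ρ + value b π ρ
value (a ∸ᵗ b)     π ρ = value a π ρ ∸ value b π ρ
value (∑ᵗ a)       π ρ = sum λ i → value a π (i ∷ ρ)

-- Register r receives the value; the registers from r on are scratch space.
-- The bound variable of a sum runs through n - 1, …, 0 in register 1 + r.

compile : Term k → Vec Register k → Register → Program
summand : Term (suc k) → Vec Register k → Register → Program

compile (const c)    xs r = r ≔const c
compile (position x) xs r = r ≔ lookup xs x
compile (letterAt x) xs r = r ≔load lookup xs x
compile (a +ᵗ b)     xs r = compile a xs r ⨾ compile b xs (1 + r) ⨾ r ≔ r ⊕ (1 + r)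
compile (a ∸ᵗ b)     xs r = compile a xs r ⨾ compile b xs (1 + r) ⨾ r ≔ r ⊖ (1 + r)
compile (∑ᵗ a)       xs r =
  r ≔const 0 ⨾ (1 + r) ≔ 0 ⨾ (whileNonzero (1 + r) repeat summand a xs r)

summand a xs r =
  (2 + r) ≔const 1 ⨾ (1 + r) ≔ (1 + r) ⊖ (2 + r) ⨾
  compile a (1 + r ∷ xs) (2 + r) ⨾ r ≔ r ⊕ (2 + r)

loopTime : ℕ → ℕ → ℕ
loopTime t zero    = 1
loopTime t (suc c) = suc (t + loopTime t c)

-- This is an exact cost rather than a bound: compiled code has no conditionals and each of its
-- loops runs n times, so the cost depends neither on the permutation nor on the assignment of the
-- variables.
time : Term k → ℕ → ℕ
time (const _)    n = 1
time (position _) n = 1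
time (letterAt _) n = 1
time (a +ᵗ b)     n = time a n + (time b n + 1)
time (a ∸ᵗ b)     n = time a n + (time b n + 1)
time (∑ᵗ a)       n = 1 + (1 + loopTime (1 + (1 + (time a n + 1))) n)

-- Correctness and exact cost of compiled terms.

update-same : ∀ f x v → (f [ x ↦ v ]) x ≡ v
update-same f x v = cong (if_then v else f x) (dec-true (x ≟ x) refl)

update-other : ∀ f {x y} v → y ≢ x → (f [ x ↦ v ]) y ≡ f y
update-other f {x} {y} v y≢x = cong (if_then v else f y) (dec-false (y ≟ x) y≢x)

-- The frame condition for code whose scratch space starts at r. Memory is included as a whole,
-- since compiled terms only read the input.
record AgreeBelow (r : Register) (s s′ : State) : Set where
  field
    registers : ∀ {y} → y < r → reg s′ y ≡ reg s y
    memory    : mem s′ ≡ mem s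

module _ {r : Register} where
  open AgreeBelow

  agree-trans : ∀ {s s′ s″} → AgreeBelow r s s′ → AgreeBelow r s′ s″ → AgreeBelow r s s″
  agree-trans a b .registers y<r = trans (b .registers y<r) (a .registers y<r)
  agree-trans a b .memory        = trans (b .memory) (a .memory)

  agree-weaken : ∀ {r′ s s′} → r ≤ r′ → AgreeBelow r′ s s′ → AgreeBelow r s s′
  agree-weaken r≤r′ a .registers y<r = a .registers (<-≤-trans y<r r≤r′)
  agree-weaken r≤r′ a .memory        = a .memory

  agree-setReg : ∀ {x v s} → r ≤ x → AgreeBelow r s (setReg x v s)
  agree-setReg {v = v} {s} r≤x .registers y<r = update-other (reg s) v (<⇒≢ (<-≤-trans y<r r≤x))
  agree-setReg r≤x .memory = refl

-- The invariant under which a term can be evaluated. Register 0 keeps the length n, which every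
-- loop copies as its counter; `0<r` and `xs<r` protect it and the variables from the scratch space.
record Represents (π : Permutation′ n) (ρ : Vec (Fin n) k)
                  (xs : Vec Register k) (r : Register) (s : State) : Set where
  field
    0<r      : 0 < r
    size     : reg s 0 ≡ n
    contents : mem s ≡ entry (oneLine π)
    xs<r     : ∀ x → lookup xs x < r
    assigned : ∀ x → reg s (lookup xs x) ≡ toℕ (lookup ρ x)

module _ {π : Permutation′ n} {ρ : Vec (Fin n) k} {xs : Vec Register k} where
  open Represents
  open AgreeBelow

  represents-agree : ∀ {r s s′} → AgreeBelow r s s′ → Represents π ρ xs r s → Represents π ρ xs r s′
  represents-agree a R .0<r        = R .0<r
  represents-agree a R .size       = trans (a .registers (R .0<r)) (R .size)
  represents-agree a R .contents   = trans (a .memory) (R .contents)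
  represents-agree a R .xs<r       = R .xs<r
  represents-agree a R .assigned x = trans (a .registers (R .xs<r x)) (R .assigned x)

  represents-suc : ∀ {r s} → Represents π ρ xs r s → Represents π ρ xs (suc r) s
  represents-suc R .0<r      = z<s
  represents-suc R .size     = R .size
  represents-suc R .contents = R .contents
  represents-suc R .xs<r x   = m<n⇒m<1+n (R .xs<r x)
  represents-suc R .assigned = R .assigned

  represents-∷ : ∀ {r s i} → reg s r ≡ toℕ i → Represents π ρ xs r s →
                 Represents π (i ∷ ρ) (r ∷ xs) (suc r) s
  represents-∷ sr R .0<r      = z<s
  represents-∷ sr R .size     = R .size
  represents-∷ sr R .contents = R .contents
  represents-∷ sr R .xs<r zero        = n<1+n _
  represents-∷ sr R .xs<r (suc x)     = m<n⇒m<1+n (R .xs<r x)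
  represents-∷ sr R .assigned zero    = sr
  represents-∷ sr R .assigned (suc x) = R .assigned x

entry-tabulate : (f : Fin n → ℕ) (i : Fin n) → entry (tabulate f) (toℕ i) ≡ f i
entry-tabulate f zero    = refl
entry-tabulate f (suc i) = entry-tabulate (f ∘ suc) i

Computes : Program → Register → ℕ → ℕ → State → Set
Computes p r v t s = ∃[ s′ ] p / s ⇓ s′ [ t ] × reg s′ r ≡ v × AgreeBelow r s s′

computes-setReg : ∀ {p r t v v′ s} → p / s ⇓ setReg r v s [ t ] → v ≡ v′ → Computes p r v′ t s
computes-setReg {r = r} {v = v} {s = s} run v≡v′ =
  _ , run , trans (update-same (reg s) r v) v≡v′ , agree-setReg ≤-refl

open AgreeBelow

-- The second operand is computed with scratch space from 1 + r on, so the first one survives in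
-- register r until the two are combined.
computes-binary : ∀ {p q r v w t u s} (_∙_ : ℕ → ℕ → ℕ) {p∙q} →
  (∀ {s} → p∙q / s ⇓ setReg r (reg s r ∙ reg s (1 + r)) s [ 1 ]) →
  Computes p r v t s → (∀ {s′} → AgreeBelow r s s′ → Computes q (1 + r) w u s′) →
  Computes (p ⨾ q ⨾ p∙q) r (v ∙ w) (t + (u + 1)) s
computes-binary {r = r} _∙_ ⇓∙ (s₁ , run₁ , v₁ , agree₁) computes₂
  with s₂ , run₂ , v₂ , agree₂ ← computes₂ agree₁ =
  _ , ⇓seq run₁ (⇓seq run₂ ⇓∙) ,
  trans (update-same (reg s₂) r _)
        (cong₂ _∙_ (trans (agree₂ .registers (n<1+n r)) v₁) v₂) ,
  agree-trans agree₁ (agree-trans (agree-weaken (n≤1+n r) agree₂) (agree-setReg ≤-refl))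

compile-correct : ∀ (a : Term k) {π : Permutation′ n} {ρ xs r s} → Represents π ρ xs r s →
  Computes (compile a xs r) r (value a π ρ) (time a n) s

-- Induction on the counter c. The positions still to be visited are the first c ones, and `h`
-- includes them in `Fin n`; the value already in register r is carried along as an accumulator. As
-- the counter runs downwards, each pass splits off the last term of the remaining sum.
loop-correct : ∀ (a : Term (suc k)) {π : Permutation′ n} {ρ xs r s} →
  ∀ c (h : Fin c → Fin n) → (∀ i → toℕ (h i) ≡ toℕ i) →
  Represents π ρ xs r s → reg s (1 + r) ≡ c →
  Computes (whileNonzero (1 + r) repeat summand a xs r)
           r (reg s r + sum (λ i → value a π (h i ∷ ρ)))
           (loopTime (1 + (1 + (time a n + 1))) c) s

compile-correct (const c) R = computes-setReg ⇓const refl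
compile-correct (position x) R = computes-setReg ⇓copy (Represents.assigned R x)
compile-correct (letterAt x) {π} {ρ} R = computes-setReg ⇓load (trans
  (cong₂ (λ f y → f y) (Represents.contents R) (Represents.assigned R x))
  (entry-tabulate (toℕ ∘ letter π) (lookup ρ x)))
compile-correct (a +ᵗ b) R = computes-binary _+_ ⇓add (compile-correct a R)
  λ agree → compile-correct b (represents-suc (represents-agree agree R))
compile-correct (a ∸ᵗ b) R = computes-binary _∸_ ⇓sub (compile-correct a R)
  λ agree → compile-correct b (represents-suc (represents-agree agree R))
compile-correct {n = n} (∑ᵗ a) {r = r} {s} R =
  let
    s₁ = setReg r 0 s
    s₂ = setReg (1 + r) (reg s₁ 0) s₁
    agree₁ = agree-setReg {r} {r} {0} {s} ≤-refl
    agree₂ = agree-setReg {r} {1 + r} {reg s₁ 0} {s₁} (n≤1+n r)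
    -- Before the first pass all n positions remain, so `h` is the identity.
    s₃ , run , v , agree₃ = loop-correct a {s = s₂} n id (λ _ → refl)
      (represents-agree (agree-trans agree₁ agree₂) R)
      -- Since 0 < r, clearing the accumulator has left n in register 0.
      (trans (update-same (reg s₁) (1 + r) _)
             (Represents.size (represents-agree agree₁ R)))
  in
  s₃ , ⇓seq ⇓const (⇓seq ⇓copy run) ,
  trans v (cong (_+ _) (trans (update-other (reg s₁) _ (<⇒≢ (n<1+n r)))
                              (update-same (reg s) r 0))) ,
  agree-trans agree₁ (agree-trans agree₂ agree₃)

loop-correct a zero h h-toℕ R c≡0 =
  _ , ⇓done c≡0 , sym (+-identityʳ _) , record { registers = λ _ → refl ; memory = refl }
loop-correct a {π} {ρ} {xs} {r} {s} (suc c) h h-toℕ R s[1+r]≡1+c =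
  let
    s₁ = setReg (2 + r) 1 s
    s₂ = setReg (1 + r) (reg s₁ (1 + r) ∸ reg s₁ (2 + r)) s₁
    r<2+r  = m<n⇒m<1+n (n<1+n r)
    agree₁ = agree-setReg {r} {2 + r} {1} {s} (<⇒≤ r<2+r)
    agree₂ = agree-setReg {r} {1 + r} {reg s₁ (1 + r) ∸ reg s₁ (2 + r)} {s₁} (n≤1+n r)
    -- The counter is decremented before the summand is evaluated: 1 + c becomes c, which is the
    -- last remaining position `fromℕ c`.
    counter₂ : reg s₂ (1 + r) ≡ c
    counter₂ = trans (update-same (reg s₁) (1 + r) _) (cong₂ _∸_
      (trans (update-other (reg s) 1 (<⇒≢ (n<1+n (1 + r)))) s[1+r]≡1+c)
      (update-same (reg s) (2 + r) 1))
    accumulator₂ : reg s₂ r ≡ reg s r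
    accumulator₂ = trans (update-other (reg s₁) _ (<⇒≢ (n<1+n r)))
                         (update-other (reg s) 1 (<⇒≢ r<2+r))
    i = h (fromℕ c)
    -- The scratch space of the summand begins at 2 + r, so both the accumulator in r and the
    -- counter in 1 + r survive.
    s₃ , run₃ , v₃ , agree₃ = compile-correct a {s = s₂}
      (represents-∷ {i = i} (trans counter₂ (sym (trans (h-toℕ (fromℕ c)) (toℕ-fromℕ c))))
        (represents-suc (represents-agree (agree-trans agree₁ agree₂) R)))
    s₄ = setReg r (reg s₃ r + reg s₃ (2 + r)) s₃
    agree₄ = agree-setReg {r} {r} {reg s₃ r + reg s₃ (2 + r)} {s₃} ≤-refl
    agree  = agree-trans agree₁ (agree-trans agree₂
               (agree-trans (agree-weaken (<⇒≤ r<2+r) agree₃) agree₄))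
    accumulator₄ : reg s₄ r ≡ reg s r + value a π (i ∷ ρ)
    accumulator₄ = trans (update-same (reg s₃) r _)
      (cong₂ _+_ (trans (agree₃ .registers r<2+r) accumulator₂) v₃)
    s₅ , run₅ , v₅ , agree₅ = loop-correct a {s = s₄} c (h ∘ inject₁)
      (λ j → trans (h-toℕ (inject₁ j)) (toℕ-inject₁ j))
      (represents-agree agree R)
      (trans (update-other (reg s₃) _ (>⇒≢ (n<1+n r)))
             (trans (agree₃ .registers (n<1+n (1 + r))) counter₂))
    term = λ j → value a π (h j ∷ ρ)
  in
  s₅ ,
  ⇓loop (λ c≡0 → 1+n≢0 (trans (sym s[1+r]≡1+c) c≡0))
    (⇓seq ⇓const (⇓seq ⇓sub (⇓seq run₃ ⇓add))) run₅ ,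
  (begin
    reg s₅ r                                         ≡⟨ v₅ ⟩
    reg s₄ r + sum (term ∘ inject₁)                  ≡⟨ cong (_+ sum (term ∘ inject₁)) accumulator₄ ⟩
    reg s r + term (fromℕ c) + sum (term ∘ inject₁)   ≡⟨ +-assoc (reg s r) _ _ ⟩
    reg s r + (term (fromℕ c) + sum (term ∘ inject₁)) ≡⟨ cong (reg s r +_) (+-comm (term (fromℕ c)) _) ⟩
    reg s r + (sum (term ∘ inject₁) + term (fromℕ c)) ≡⟨ cong (reg s r +_) (sum-init-last term) ⟨
    reg s r + sum term                               ∎) ,
  agree-trans agree agree₅
  where open ≡-Reasoning

-- Evaluation takes place from register 1 on because register 0 must keep n until the result is
-- copied there at the end.
program : Term 0 → Program
program a = compile a [] 1 ⨾ 0 ≔ 1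

program-correct : ∀ (a : Term 0) (π : Permutation′ n) →
  program a on oneLine π Outputs value a π [] InTime (time a n + 1)
program-correct a π
  with s , run , v , _ ← compile-correct a {π} {[]} {[]} {1} {initial (oneLine π)} record
         { 0<r = z<s ; size = length-tabulate (toℕ ∘ letter π) ; contents = refl
         ; xs<r = λ () ; assigned = λ () } =
  _ , ⇓seq run ⇓copy , trans (update-same (reg s) 0 _) v

-- Polynomial bounds on the running time.

PolynomiallyBounded : (ℕ → ℕ) → Set
PolynomiallyBounded f = ∃[ c ] ∃[ d ] (∀ n .{{_ : NonZero n}} → f n ≤ c * n ^ d)

bounded-const : ∀ c → PolynomiallyBounded (λ _ → c)
bounded-const c = c , 0 , λ n → ≤-reflexive (sym (*-identityʳ c))

-- For n ≥ 1 powers of n grow with the exponent, so d + d′ serves as a common exponent for both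
-- summands.
bounded-+ : ∀ {f g} → PolynomiallyBounded f → PolynomiallyBounded g →
            PolynomiallyBounded (λ n → f n + g n)
bounded-+ {f} {g} (c , d , f≤) (c′ , d′ , g≤) = c + c′ , d + d′ , λ n → begin
  f n + g n                              ≤⟨ +-mono-≤ (f≤ n) (g≤ n) ⟩
  c * n ^ d + c′ * n ^ d′                ≤⟨ +-mono-≤ (*-monoʳ-≤ c (^-monoʳ-≤ n (m≤m+n d d′)))
                                                     (*-monoʳ-≤ c′ (^-monoʳ-≤ n (m≤n+m d′ d))) ⟩
  c * n ^ (d + d′) + c′ * n ^ (d + d′)   ≡⟨ *-distribʳ-+ (n ^ (d + d′)) c c′ ⟨
  (c + c′) * n ^ (d + d′)                ∎
  where open ≤-Reasoning

bounded-n* : ∀ {f} → PolynomiallyBounded f → PolynomiallyBounded (λ n → n * f n)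
bounded-n* {f} (c , d , f≤) = c , suc d , λ n → begin
  n * f n          ≤⟨ *-monoʳ-≤ n (f≤ n) ⟩
  n * (c * n ^ d)  ≡⟨ *-assoc n c _ ⟨
  n * c * n ^ d    ≡⟨ cong (_* n ^ d) (*-comm n c) ⟩
  c * n * n ^ d    ≡⟨ *-assoc c n _ ⟩
  c * n ^ suc d    ∎
  where open ≤-Reasoning

bounded-≗ : ∀ {f g} → f ≗ g → PolynomiallyBounded f → PolynomiallyBounded g
bounded-≗ f≗g (c , d , f≤) = c , d , λ n → ≤-trans (≤-reflexive (sym (f≗g n))) (f≤ n)

-- Each of the c passes costs its body and one test; the final 1 is the failing test.
loopTime-closed : ∀ t c → c * suc t + 1 ≡ loopTime t c
loopTime-closed t zero    = refl
loopTime-closed t (suc c) = cong suc (trans (+-assoc t _ 1) (cong (t +_) (loopTime-closed t c)))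

time-bounded : (a : Term k) → PolynomiallyBounded (time a)
time-bounded (const _)    = bounded-const 1
time-bounded (position _) = bounded-const 1
time-bounded (letterAt _) = bounded-const 1
time-bounded (a +ᵗ b) = bounded-+ (time-bounded a) (bounded-+ (time-bounded b) (bounded-const 1))
time-bounded (a ∸ᵗ b) = bounded-+ (time-bounded a) (bounded-+ (time-bounded b) (bounded-const 1))
time-bounded (∑ᵗ a) = bounded-≗
  (λ n → cong (2 +_) (loopTime-closed (1 + (1 + (time a n + 1))) n))
  -- The constants count instructions: 2 initialise accumulator and counter, 3 are the test and the
  -- two assignments that decrement the counter in each pass, the next 1 is the addition to the
  -- accumulator, and the last 1 is the failing test.
  (bounded-+ (bounded-const 2) (bounded-+
    (bounded-n* (bounded-+ (bounded-const 3) (bounded-+ (time-bounded a) (bounded-const 1))))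
    (bounded-const 1)))

-- First-order formulas over positions and their arithmetisation.

open Equivalence using (to; from)

-- Quantifiers range over the positions of π and become loops, whereas `⋀` and `⋁` range over a
-- fixed index set and are unrolled. `decided` admits conditions on σ alone, settled when the
-- program is built. `_≈ᵖ_` differs from `_≐_` in meaning equality in `Fin n` rather than in `ℕ`.
data Formula (k : ℕ) : Set₁ where
  _≼_ _≐_     : Term k → Term k → Formula k
  _≈ᵖ_        : Fin k → Fin k → Formula k
  decided     : {A : Set} → Dec A → Formula k
  _∧_ _∨_ _⇒_ : Formula k → Formula k → Formula k
  ∀ᶠ ∃ᶠ       : Formula (suc k) → Formula k
  ⋀ ⋁         : (Fin q → Formula k) → Formula k

infix  5 _≼_ _≐_ _≈ᵖ_
infixr 4 _∧_ _∨_
infixr 3 _⇒_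

Holds : Formula k → Permutation′ n → Vec (Fin n) k → Set
Holds (a ≼ b)             π ρ = value a π ρ ≤ value b π ρ
Holds (a ≐ b)             π ρ = value a π ρ ≡ value b π ρ
Holds (x ≈ᵖ y)            π ρ = lookup ρ x ≡ lookup ρ y
Holds (decided {A} _)     π ρ = A
Holds (φ ∧ ψ)             π ρ = Holds φ π ρ × Holds ψ π ρ
Holds (φ ∨ ψ)             π ρ = Holds φ π ρ ⊎ Holds ψ π ρ
Holds (φ ⇒ ψ)             π ρ = Holds φ π ρ → Holds ψ π ρ
Holds {n = n} (∀ᶠ φ)      π ρ = ∀ (i : Fin n) → Holds φ π (i ∷ ρ)
Holds (∃ᶠ φ)              π ρ = ∃[ i ] Holds φ π (i ∷ ρ)
Holds (⋀ {q = q} φ)       π ρ = ∀ (j : Fin q) → Holds (φ j) π ρ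
Holds (⋁ φ)               π ρ = ∃[ j ] Holds (φ j) π ρ

⨁ : (Fin q → Term k) → Term k
⨁ {zero}  a = const 0
⨁ {suc q} a = a zero +ᵗ ⨁ (a ∘ suc)

value-⨁ : (a : Fin q → Term k) (π : Permutation′ n) (ρ : Vec (Fin n) k) →
          value (⨁ a) π ρ ≡ sum (λ j → value (a j) π ρ)
value-⨁ {zero}  a π ρ = refl
value-⨁ {suc q} a π ρ = cong (value (a zero) π ρ +_) (value-⨁ (a ∘ suc) π ρ)

-- A defect of 0 stands for truth, so that conjunctions are sums.

defect : Formula k → Term k
defect (a ≼ b)     = a ∸ᵗ b
defect (a ≐ b)     = (a ∸ᵗ b) +ᵗ (b ∸ᵗ a)
defect (x ≈ᵖ y)    = (position x ∸ᵗ position y) +ᵗ (position y ∸ᵗ position x)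
defect (decided d) = const (if does d then 0 else 1)
defect (φ ∧ ψ)     = defect φ +ᵗ defect ψ
defect (φ ∨ ψ)     = const 1 ∸ᵗ ((const 1 ∸ᵗ defect φ) +ᵗ (const 1 ∸ᵗ defect ψ))
defect (φ ⇒ ψ)     = const 1 ∸ᵗ (defect φ +ᵗ (const 1 ∸ᵗ defect ψ))
defect (∀ᶠ φ)      = ∑ᵗ (defect φ)
defect (∃ᶠ φ)      = const 1 ∸ᵗ ∑ᵗ (const 1 ∸ᵗ defect φ)
defect (⋀ φ)       = ⨁ (λ j → defect (φ j))
defect (⋁ φ)       = const 1 ∸ᵗ ⨁ (λ j → const 1 ∸ᵗ defect (φ j))

-- The map v ↦ 1 ∸ v exchanges zero and nonzero, whatever the size of v. With negation at hand, the
-- other connectives follow from conjunction by De Morgan's laws.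
¬-defect : ∀ {P : Set} {v} → P ⇔ v ≡ 0 → (¬ P) ⇔ 1 ∸ v ≡ 0
¬-defect {v = zero}  e = mk⇔ (λ ¬p → contradiction (e .from refl) ¬p) λ ()
¬-defect {v = suc v} e = mk⇔ (λ _ → 0∸n≡0 v) λ _ p → 1+n≢0 (e .to p)

defect-decidable : ∀ {P : Set} {v} → P ⇔ v ≡ 0 → Dec P
defect-decidable {v = v} e = map′ (e .from) (e .to) (v ≟ 0)

×-defect : ∀ {P Q : Set} {v w} → P ⇔ v ≡ 0 → Q ⇔ w ≡ 0 → (P × Q) ⇔ v + w ≡ 0
×-defect {v = v} e f = mk⇔
  (λ (p , q) → cong₂ _+_ (e .to p) (f .to q))
  (λ v+w≡0 → e .from (m+n≡0⇒m≡0 v v+w≡0) , f .from (m+n≡0⇒n≡0 v v+w≡0))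

⇔-defect : ∀ {P Q : Set} {v} → (P → Q) → (Q → P) → P ⇔ v ≡ 0 → Q ⇔ v ≡ 0
⇔-defect p⇒q q⇒p e = mk⇔ (e .to ∘ q⇒p) (p⇒q ∘ e .from)

≤-defect : ∀ a b → a ≤ b ⇔ a ∸ b ≡ 0
≤-defect a b = mk⇔ m≤n⇒m∸n≡0 m∸n≡0⇒m≤n

≡-defect : ∀ a b → a ≡ b ⇔ (a ∸ b) + (b ∸ a) ≡ 0
≡-defect a b = ⇔-defect (λ (a≤b , b≤a) → ≤-antisym a≤b b≤a)
  (λ a≡b → ≤-reflexive a≡b , ≤-reflexive (sym a≡b))
  (×-defect (≤-defect a b) (≤-defect b a))

Π-defect : ∀ {P : Fin n → Set} {v : Fin n → ℕ} →
           (∀ i → P i ⇔ v i ≡ 0) → (∀ i → P i) ⇔ sum v ≡ 0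
Π-defect {n = zero}  e = mk⇔ (λ _ → refl) λ _ ()
Π-defect {n = suc n} e = ⇔-defect
  (λ where (p , ps) zero → p ; (p , ps) (suc i) → ps i)
  (λ ps → ps zero , ps ∘ suc)
  (×-defect (e zero) (Π-defect (e ∘ suc)))

-- Existence is encoded as ¬∀¬. The double negation can be removed because each `P i` is decided by
-- its defect and the range is finite.
Σ-defect : ∀ {P : Fin n → Set} {v : Fin n → ℕ} →
           (∀ i → P i ⇔ v i ≡ 0) → (∃[ i ] P i) ⇔ 1 ∸ sum (λ i → 1 ∸ v i) ≡ 0
Σ-defect e = ⇔-defect
  (λ ¬∀¬ → decidable-stable (any? (defect-decidable ∘ e)) λ ¬∃ → ¬∀¬ λ i p → ¬∃ (i , p))
  (λ (i , p) ∀¬ → ∀¬ i p)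
  (¬-defect (Π-defect (¬-defect ∘ e)))

-- Induction on the formula, mutual with `holds?`: the classical encodings of `_∨_` and `_⇒_` need
-- their subformulas to be decidable, and decidability is read off the defect being zero or not.
defect-correct : ∀ (φ : Formula k) (π : Permutation′ n) ρ → Holds φ π ρ ⇔ value (defect φ) π ρ ≡ 0
holds? : (φ : Formula k) (π : Permutation′ n) → Decidable (Holds φ π)

defect-correct (a ≼ b) π ρ = ≤-defect (value a π ρ) (value b π ρ)
defect-correct (a ≐ b) π ρ = ≡-defect (value a π ρ) (value b π ρ)
defect-correct (x ≈ᵖ y) π ρ = ⇔-defect toℕ-injective (cong toℕ) (≡-defect _ _)
defect-correct (decided (yes a)) π ρ = mk⇔ (λ _ → refl) (λ _ → a)
defect-correct (decided (no ¬a)) π ρ = mk⇔ (λ a → contradiction a ¬a) λ ()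
defect-correct (φ ∧ ψ) π ρ = ×-defect (defect-correct φ π ρ) (defect-correct ψ π ρ)
defect-correct (φ ∨ ψ) π ρ = ⇔-defect
  (λ ¬[¬p×¬q] → decidable-stable (holds? φ π ρ ⊎-dec holds? ψ π ρ)
    λ ¬[p⊎q] → ¬[¬p×¬q] (¬[p⊎q] ∘ inj₁ , ¬[p⊎q] ∘ inj₂))
  (λ p⊎q (¬p , ¬q) → [ ¬p , ¬q ]′ p⊎q)
  (¬-defect (×-defect (¬-defect (defect-correct φ π ρ)) (¬-defect (defect-correct ψ π ρ))))
defect-correct (φ ⇒ ψ) π ρ = ⇔-defect
  (λ ¬[p×¬q] p → decidable-stable (holds? ψ π ρ) λ ¬q → ¬[p×¬q] (p , ¬q))
  (λ p⇒q (p , ¬q) → ¬q (p⇒q p))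
  (¬-defect (×-defect (defect-correct φ π ρ) (¬-defect (defect-correct ψ π ρ))))
defect-correct (∀ᶠ φ) π ρ = Π-defect λ i → defect-correct φ π (i ∷ ρ)
defect-correct (∃ᶠ φ) π ρ = Σ-defect λ i → defect-correct φ π (i ∷ ρ)
defect-correct (⋀ φ) π ρ rewrite value-⨁ (λ j → defect (φ j)) π ρ =
  Π-defect λ j → defect-correct (φ j) π ρ
defect-correct (⋁ φ) π ρ rewrite value-⨁ (λ j → const 1 ∸ᵗ defect (φ j)) π ρ =
  Σ-defect λ j → defect-correct (φ j) π ρ

holds? φ π ρ = defect-decidable (defect-correct φ π ρ)

-- Counting the satisfying tuples by nested sums.

tuples : ∀ n k → List (Vec (Fin n) k)
tuples n zero    = [] ∷ []
tuples n (suc k) = cartesianProductWith (λ ρ i → i ∷ ρ) (tuples n k) (allFin n)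

∑ᵗ* : Term k → Term 0
∑ᵗ* {zero}  a = a
∑ᵗ* {suc k} a = ∑ᵗ* (∑ᵗ a)

module _ {A B C : Set} (g : C → ℕ) (f : A → B → C) (ys : List B) where

  sum-cartesianProductWith : ∀ xs →
    sumˡ (map g (cartesianProductWith f xs ys)) ≡ sumˡ (map (λ x → sumˡ (map (g ∘ f x) ys)) xs)
  sum-cartesianProductWith []       = refl
  sum-cartesianProductWith (x ∷ xs) = begin
    sumˡ (map g (map (f x) ys ++ rest))                 ≡⟨ cong sumˡ (map-++ g (map (f x) ys) rest) ⟩
    sumˡ (map g (map (f x) ys) ++ map g rest)           ≡⟨ sum-++ (map g (map (f x) ys)) _ ⟩
    sumˡ (map g (map (f x) ys)) + sumˡ (map g rest)     ≡⟨ cong₂ _+_ (cong sumˡ (sym (map-∘ ys)))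
                                                                     (sum-cartesianProductWith xs) ⟩
    sumˡ (map (g ∘ f x) ys) + sumˡ (map (λ x → sumˡ (map (g ∘ f x) ys)) xs) ∎
    where
    open ≡-Reasoning
    rest = cartesianProductWith f xs ys

sum-tabulate : (f : Fin n → ℕ) → sumˡ (tabulate f) ≡ sum f
sum-tabulate {n = zero}  f = refl
sum-tabulate {n = suc n} f = cong (f zero +_) (sum-tabulate (f ∘ suc))

-- The innermost sum binds the head of the tuple, and `tuples` varies the head fastest, so nested
-- sum and list product are peeled off in the same order.
value-∑ᵗ* : ∀ (a : Term k) (π : Permutation′ n) →
            value (∑ᵗ* a) π [] ≡ sumˡ (map (value a π) (tuples n k))
value-∑ᵗ* {k = zero}  a π = sym (+-identityʳ _)
value-∑ᵗ* {k = suc k} {n} a π = begin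
  value (∑ᵗ* (∑ᵗ a)) π []
    ≡⟨ value-∑ᵗ* (∑ᵗ a) π ⟩
  sumˡ (map (λ ρ → sum λ i → value a π (i ∷ ρ)) (tuples n k))
    ≡⟨ cong sumˡ (map-cong inner (tuples n k)) ⟨
  sumˡ (map (λ ρ → sumˡ (map (λ i → value a π (i ∷ ρ)) (allFin n))) (tuples n k))
    ≡⟨ sum-cartesianProductWith (value a π) _ (allFin n) (tuples n k) ⟨
  sumˡ (map (value a π) (tuples n (suc k)))
    ∎
  where
  open ≡-Reasoning
  inner : ∀ ρ → sumˡ (map (λ i → value a π (i ∷ ρ)) (allFin n)) ≡ sum λ i → value a π (i ∷ ρ)
  inner ρ = trans (cong sumˡ (map-tabulate id term)) (sum-tabulate term)
    where term = λ i → value a π (i ∷ ρ)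

-- The number 1 ∸ v x is the indicator of `P x`: it is 1 at defect 0 and vanishes otherwise.
length-filter-defect : ∀ {A : Set} {P : Pred A 0ℓ} (P? : Decidable P) {v : A → ℕ} →
  (∀ x → P x ⇔ v x ≡ 0) → ∀ xs → length (filter P? xs) ≡ sumˡ (map (λ x → 1 ∸ v x) xs)
length-filter-defect P? e [] = refl
length-filter-defect P? {v} e (x ∷ xs) with P? x
... | yes p = cong₂ _+_ (sym (cong (1 ∸_) (e x .to p))) (length-filter-defect P? e xs)
... | no ¬p = cong₂ _+_ (sym (¬-defect (e x) .to ¬p)) (length-filter-defect P? e xs)

count : Formula k → Term 0
count φ = ∑ᵗ* (const 1 ∸ᵗ defect φ)

value-count : (φ : Formula k) (π : Permutation′ n) →
              value (count φ) π [] ≡ length (filter (holds? φ π) (tuples n k))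
value-count φ π = trans (value-∑ᵗ* (const 1 ∸ᵗ defect φ) π)
  (sym (length-filter-defect (holds? φ π) (defect-correct φ π) (tuples _ _)))

-- Normal occurrences as a first-order formula.

-- Holds turns each of the following formulas definitionally into the predicate
-- that it encodes.

_≤ᵖ_ _<ᵖ_ _<ˡ_ : Fin k → Fin k → Formula k
x ≤ᵖ y = position x ≼ position y
x <ᵖ y = const 1 +ᵗ position x ≼ position y
x <ˡ y = const 1 +ᵗ letterAt x ≼ letterAt y

infix 5 _≤ᵖ_ _<ᵖ_ _<ˡ_

occurrence : Permutation′ m → Formula m
occurrence σ =
  (⋀ λ j → ⋀ λ k → decided (j <ᶠ? k) ⇒ j <ᵖ k) ∧
  (⋀ λ j → ⋀ λ k →
    (decided (letter σ j <ᶠ? letter σ k) ⇒ j <ˡ k) ∧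
    (j <ˡ k ⇒ decided (letter σ j <ᶠ? letter σ k)))

-- De Bruijn indices under a pair of quantifiers: `1ᵛ` is bound by the outer one, `0ᵛ` by the inner
-- one, and `↑` shifts an older variable past both.
pattern 0ᵛ = zero
pattern 1ᵛ = suc zero
pattern ↑ x = suc (suc x)

increasing decreasing run adjacency : Fin k → Fin k → Formula k
increasing a b = ∀ᶠ (∀ᶠ (↑ a ≤ᵖ 1ᵛ ⇒ 0ᵛ ≤ᵖ ↑ b ⇒ position 0ᵛ ≐ const 1 +ᵗ position 1ᵛ ⇒
  letterAt 0ᵛ ≐ const 1 +ᵗ letterAt 1ᵛ))
decreasing a b = ∀ᶠ (∀ᶠ (↑ a ≤ᵖ 1ᵛ ⇒ 0ᵛ ≤ᵖ ↑ b ⇒ position 0ᵛ ≐ const 1 +ᵗ position 1ᵛ ⇒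
  letterAt 1ᵛ ≐ const 1 +ᵗ letterAt 0ᵛ))
run a b = a ≤ᵖ b ∧ (increasing a b ∨ decreasing a b)
adjacency a b = run a b ∧
  ∀ᶠ (∀ᶠ (1ᵛ ≤ᵖ ↑ a ⇒ ↑ b ≤ᵖ 0ᵛ ⇒ run 1ᵛ 0ᵛ ⇒ 1ᵛ ≈ᵖ ↑ a ∧ 0ᵛ ≈ᵖ ↑ b))

inTail : Fin k → Formula k
inTail i = ∃ᶠ (∃ᶠ (adjacency 1ᵛ 0ᵛ ∧ 1ᵛ <ᵖ ↑ i ∧ ↑ i ≤ᵖ 0ᵛ))

normalOccurrence : Permutation′ m → Formula m
normalOccurrence σ = occurrence σ ∧ ∀ᶠ (inTail 0ᵛ ⇒ ⋁ λ j → 0ᵛ ≈ᵖ suc j)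

IsNormalOccurrence : Permutation′ m → Permutation′ n → Vec (Fin n) m → Set
IsNormalOccurrence σ π ι =
  IsOccurrence σ π ι × (∀ i → InTail π i → ∃[ j ] i ≡ lookup ι j)

isNormalOccurrence? : (σ : Permutation′ m) (π : Permutation′ n) → Decidable (IsNormalOccurrence σ π)
-- `Holds (normalOccurrence σ) π` reduces to `IsNormalOccurrence σ π`.
isNormalOccurrence? σ = holds? (normalOccurrence σ)

-- Duplicate-free enumerations and counting by bijection.

allSequences-unique : ∀ q n → Unique (allSequences q n)
allSequences-unique q zero    = [] ∷ []
allSequences-unique q (suc n) =
  cartesianProductWith⁺ _∷_ ∷-injective (allFin⁺ q) (allSequences-unique q n)

∈-allSequences : (xs : Vec (Fin q) n) → xs ∈ allSequences q n
∈-allSequences []       = here refl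
∈-allSequences (x ∷ xs) = ∈-cartesianProductWith⁺ _∷_ (∈-allFin x) (∈-allSequences xs)

tuples-unique : ∀ n k → Unique (tuples n k)
tuples-unique n zero    = [] ∷ []
tuples-unique n (suc k) = cartesianProductWith⁺ _
  (λ eq → proj₂ (∷-injective eq) , proj₁ (∷-injective eq)) (tuples-unique n k) (allFin⁺ n)

∈-tuples : (xs : Vec (Fin n) k) → xs ∈ tuples n k
∈-tuples []       = here refl
∈-tuples (x ∷ xs) = ∈-cartesianProductWith⁺ _ (∈-tuples xs) (∈-allFin x)

-- Injectivity is demanded only on `P`, because `embed π` forgets the order of a tuple and is
-- injective only on ascending ones.
map-unique : ∀ {A B : Set} {P : Pred A 0ℓ} {f : A → B} →
  (∀ {x y} → P x → P y → f x ≡ f y → x ≡ y) →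
  ∀ {xs} → All P xs → Unique xs → Unique (map f xs)
map-unique inj []         []           = []
map-unique inj (px ∷ pxs) (x∉xs ∷ xs!) =
  all-map⁺ (All.zipWith (λ (py , x≢y) fx≡fy → x≢y (inj px py fx≡fy)) (pxs , x∉xs)) ∷
  map-unique inj pxs xs!

module _ {A B : Set} {P : Pred A 0ℓ} {Q : Pred B 0ℓ} (P? : Decidable P) (Q? : Decidable Q)
         {xs : List A} {ys : List B} (f : A → B) where

  -- The filtered `ys` and the image of the filtered `xs` are duplicate-free lists with the same
  -- members, hence permutations of each other.
  length-filter-bijective :
    Unique xs → Unique ys → (∀ x → x ∈ xs) → (∀ y → y ∈ ys) →
    (∀ x → P x → Q (f x)) → (∀ y → Q y → ∃[ x ] P x × y ≡ f x) →
    (∀ {x y} → P x → P y → f x ≡ f y → x ≡ y) →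
    length (filter Q? ys) ≡ length (filter P? xs)
  length-filter-bijective xs! ys! ∈xs ∈ys P⇒Q Q⇒P inj = trans
    (↭-length (∼bag⇒↭ (unique∧set⇒bag (filter⁺ Q? ys!)
      (map-unique inj (all-filter P? xs) (filter⁺ P? xs!)) (mk⇔ ⊆ ⊇))))
    (length-map f (filter P? xs))
    where
    ⊆ : ∀ {y} → y ∈ filter Q? ys → y ∈ map f (filter P? xs)
    ⊆ y∈ with x , p , refl ← Q⇒P _ (proj₂ (∈-filter⁻ Q? {xs = ys} y∈)) =
      ∈-map⁺ f (∈-filter⁺ P? (∈xs x) p)

    ⊇ : ∀ {y} → y ∈ map f (filter P? xs) → y ∈ filter Q? ys
    ⊇ y∈ with x , x∈ , refl ← ∈-map⁻ f y∈ =
      ∈-filter⁺ Q? (∈ys (f x)) (P⇒Q x (proj₂ (∈-filter⁻ P? {xs = xs} x∈)))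

-- Ascending tuples of positions and the sequences they embed.

Ascending : Vec (Fin n) m → Set
Ascending {m = m} ι = ∀ (j k : Fin m) → j <ᶠ k → lookup ι j <ᶠ lookup ι k

module _ {x : Fin n} {xs : Vec (Fin n) m} (asc : Ascending (x ∷ xs)) where

  ascending-tail : Ascending xs
  ascending-tail j k j<k = asc (suc j) (suc k) (s<s j<k)

  ascending-head : ∀ {y} → y Vec∈.∈ xs → x <ᶠ y
  ascending-head y∈xs = subst (x <ᶠ_) (sym (lookup-index y∈xs)) (asc zero (suc (Any.index y∈xs)) z<s)

-- Both heads are the least entry of the common set, hence equal. Strictness keeps this entry out of
-- both tails, so the inclusions restrict to the tails and induction applies.
ascending-≡ : ∀ {ι κ : Vec (Fin n) m} → Ascending ι → Ascending κ →
  (∀ {i} → i Vec∈.∈ ι → i Vec∈.∈ κ) → (∀ {i} → i Vec∈.∈ κ → i Vec∈.∈ ι) → ι ≡ κ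
ascending-≡ {ι = []}     {[]}     _    _    _   _   = refl
ascending-≡ {ι = x ∷ xs} {y ∷ ys} asc₁ asc₂ ι⊆κ κ⊆ι with ι⊆κ (here refl) | κ⊆ι (here refl)
... | there x∈ys | there y∈xs =
  contradiction (ascending-head asc₁ y∈xs) (<ᶠ-asym (ascending-head asc₂ x∈ys))
... | there x∈ys | here refl =
  contradiction (ascending-head asc₂ x∈ys) (<ᶠ-irrefl refl)
... | here refl | _ = cong (x ∷_) (ascending-≡ (ascending-tail asc₁) (ascending-tail asc₂)
  (λ i∈xs → drop (ascending-head asc₁ i∈xs) (ι⊆κ (there i∈xs)))
  (λ i∈ys → drop (ascending-head asc₂ i∈ys) (κ⊆ι (there i∈ys))))
  where
  drop : ∀ {i m} {zs : Vec _ m} → x <ᶠ i → i Vec∈.∈ x ∷ zs → i Vec∈.∈ zs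
  drop x<i (here refl)  = contradiction x<i (<ᶠ-irrefl refl)
  drop x<i (there i∈zs) = i∈zs

embed : Permutation′ n → Vec (Fin n) m → Vec (Fin (suc n)) n
embed π ι = Vec.tabulate λ i → if does (_∈?_ _≟ᶠ_ i ι) then letter π i else zero

module _ (π : Permutation′ n) (ι : Vec (Fin n) m) where

  lookup-embed-∈ : ∀ {i} → i Vec∈.∈ ι → lookup (embed π ι) i ≡ letter π i
  lookup-embed-∈ {i} i∈ι = trans (lookup∘tabulate _ i)
    (cong (if_then letter π i else zero) (dec-true (_∈?_ _≟ᶠ_ i ι) i∈ι))

  lookup-embed-∉ : ∀ {i} → i Vec∈.∉ ι → lookup (embed π ι) i ≡ zero
  lookup-embed-∉ {i} i∉ι = trans (lookup∘tabulate _ i)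
    (cong (if_then letter π i else zero) (dec-false (_∈?_ _≟ᶠ_ i ι) i∉ι))

  embed-unique : ∀ η → (∀ j → lookup η (lookup ι j) ≡ letter π (lookup ι j)) →
                 (∀ i → i Vec∈.∉ ι → lookup η i ≡ zero) → η ≡ embed π ι
  embed-unique η on off =
    trans (sym (tabulate∘lookup η)) (trans (tabulate-cong pointwise) (tabulate∘lookup _))
    where
    pointwise : ∀ i → lookup η i ≡ lookup (embed π ι) i
    pointwise i with _∈?_ _≟ᶠ_ i ι
    ... | yes i∈ι = trans
      (subst (λ i → lookup η i ≡ letter π i) (sym (lookup-index i∈ι)) (on (Any.index i∈ι)))
      (sym (lookup-embed-∈ i∈ι))
    ... | no  i∉ι = trans (off i i∉ι) (sym (lookup-embed-∉ i∉ι))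

  lookup-embed⁻ : ∀ {i} → lookup (embed π ι) i ≢ zero → i Vec∈.∈ ι
  lookup-embed⁻ {i} ≢0 = decidable-stable (_∈?_ _≟ᶠ_ i ι) (≢0 ∘ lookup-embed-∉)

-- Letters start from 1, so the nonzero entries of an embedded sequence mark exactly the chosen
-- positions.
embed-⊆ : ∀ (π : Permutation′ n) (ι κ : Vec (Fin n) m) → embed π ι ≡ embed π κ →
          ∀ {i} → i Vec∈.∈ ι → i Vec∈.∈ κ
embed-⊆ π ι κ eq {i} i∈ι = lookup-embed⁻ π κ λ ≡0 →
  letter≢0 (trans (sym (lookup-embed-∈ π ι i∈ι)) (trans (cong (λ η → lookup η i) eq) ≡0))
  where
  letter≢0 : letter π i ≢ zero
  letter≢0 ()

embed-injective : ∀ (π : Permutation′ n) {ι κ : Vec (Fin n) m} →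
  Ascending ι → Ascending κ → embed π ι ≡ embed π κ → ι ≡ κ
embed-injective π {ι} {κ} asc₁ asc₂ eq =
  ascending-≡ asc₁ asc₂ (embed-⊆ π ι κ eq) (embed-⊆ π κ ι (sym eq))

-- Normal embeddings, normal occurrences and the resulting algorithm.

module _ (σ : Permutation′ m) (π : Permutation′ n) where

  embed-normal : ∀ ι → IsNormalOccurrence σ π ι → IsNormalEmbedding σ π (embed π ι)
  embed-normal ι (occ , covers) =
    (ι , occ , (λ j → lookup-embed-∈ π ι (∈-lookup j ι)) , λ i → lookup-embed-∉ π ι) , nonzero
    where
    nonzero : ∀ i → InTail π i → lookup (embed π ι) i ≢ zero
    nonzero i tail ≡0 with j , refl ← covers i tail
      with () ← trans (sym (lookup-embed-∈ π ι (∈-lookup j ι))) ≡0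

  normal-embed : ∀ η → IsNormalEmbedding σ π η → ∃[ ι ] IsNormalOccurrence σ π ι × η ≡ embed π ι
  -- The conditions on and off `ι` determine every entry of `η`, so `η` can be replaced by
  -- `embed π ι`. A nonzero entry at a tail position then says that `ι` contains this position.
  normal-embed η ((ι , occ , on , off) , nonzero) with refl ← embed-unique π ι η on off =
    ι , (occ , λ i tail → let i∈ι = lookup-embed⁻ π ι (nonzero i tail) in
                          Any.index i∈ι , lookup-index i∈ι) , refl

  NE≡length-normalOccurrences : NE σ π ≡ length (filter (isNormalOccurrence? σ π) (tuples n m))
  NE≡length-normalOccurrences =
    length-filter-bijective (isNormalOccurrence? σ π) (isNormalEmbedding? σ π) (embed π)
      (tuples-unique n m) (allSequences-unique (suc n) n) ∈-tuples ∈-allSequences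
      embed-normal normal-embed
      -- The first half of `IsOccurrence` says that the positions ascend.
      (λ p q → embed-injective π (proj₁ (proj₁ p)) (proj₁ (proj₁ q)))

proposition5 : ∀ (m : ℕ) .{{_ : NonZero m}} (σ : Permutation′ m) →
    ∃[ p ] ∃[ c ] ∃[ d ]
    (∀ (n : ℕ) .{{_ : NonZero n}} (π : Permutation′ n) →
    ∃[ t ] (p on oneLine π Outputs NE σ π InTime t) × t ≤ c * n ^ d)
proposition5 m σ =
  -- The term is built from σ alone, so the program and both constants are fixed before n and π. The
  -- 1 added to the bound pays for copying the result to register 0.
  let a = count (normalOccurrence σ)
      c , d , bound = bounded-+ (time-bounded a) (bounded-const 1)
  in program a , c , d , λ n π →
     time a n + 1 ,
     subst (λ v → program a on oneLine π Outputs v InTime (time a n + 1))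
       (trans (value-count (normalOccurrence σ) π) (sym (NE≡length-normalOccurrences σ π)))
       (program-correct a π) ,
     bound n
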